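{- Let $s_1,d_1,s_2,d_2$ be non-negative integers such that $\{s_1,d_1\}\neq\{s_2,d_2\}$ and $s_1+d_1=s_2+d_2\geq 2$. Then there exists a finite, non-empty set $A\subset\mathbb{Z}^2$, contained in an $n\times n$ integer lattice $\{0,1,\dots,n\}^2$ for some sufficiently large $n$, such that $$|s_1A-d_1A|>|s_2A-d_2A|.$$
   Context: For a finite set $A\subset\mathbb{Z}^2$ and non-negative integers $s,d$, define $sA-dA=\{x_1+\cdots+x_s-y_1-\cdots-y_d : x_i,y_j\in A\}$ (the $s$-fold sumset minus the $d$-fold sumset, with the empty sum equal to $0$). -}

module Defs where

open import Data.Nat using (ℕ; zero; suc)
open import Data.Integer as ℤ using (ℤ; +_)
import Data.Integer.Properties as ℤP
open import Data.Product using (_×_; _,_; proj₁; proj₂)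
open import Data.Product.Properties using (≡-dec)
open import Data.List using (List; []; _∷_; length; deduplicate; cartesianProductWith)
open import Data.List.Membership.Propositional using (_∈_)
open import Relation.Binary.PropositionalEquality using (_≡_)
open import Relation.Binary.Definitions using (DecidableEquality)

Point : Set
Point = ℤ × ℤ

_≟P_ : DecidableEquality Point
_≟P_ = ≡-dec ℤP._≟_ ℤP._≟_

origin : Point
origin = (+ 0 , + 0)

_+P_ : Point → Point → Point
(a , b) +P (c , d) = (a ℤ.+ c , b ℤ.+ d)

_-P_ : Point → Point → Point
(a , b) -P (c , d) = (a ℤ.- c , b ℤ.- d)

-- A finite set A ⊂ ℤ² is represented by a list of its elements
-- (duplicates are harmless: all notions below depend only on membership).

fold : ℕ → List Point → List Point
fold zero    A = origin ∷ []
fold (suc k) A = cartesianProductWith _+P_ A (fold k A)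

sumDiff : ℕ → ℕ → List Point → List Point
sumDiff s d A = cartesianProductWith _-P_ (fold s A) (fold d A)

card : List Point → ℕ
card xs = length (deduplicate _≟P_ xs)

InBox : ℕ → List Point → Set
InBox n A = ∀ {p} → p ∈ A →
  (+ 0 ℤ.≤ proj₁ p) × (proj₁ p ℤ.≤ + n) × (+ 0 ℤ.≤ proj₂ p) × (proj₂ p ℤ.≤ + n)

{-# OPTIONS --safe #-}
-- On a line take A = L ∪ [K, n − K] ∪ (n − R) with n = 4K, where L and R contain 0 and are small
-- compared with K. If s + d = h ≥ 1, translating sA − dA by dn gives the subset of [0, hn] made of
-- sL + dR at the left end, all of [K, hn − K], and the mirror image of sR + dL at the right end.
-- Hence |sA − dA| = |sL + dR| + |sR + dL| + const, with a constant depending only on h and K.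
-- For L = {0, 1, a} and R = {0} with a > h the two sumsets have (s+1)(s+2)/2 and (d+1)(d+2)/2
-- elements, so the cardinality decreases with sd; for L = {0, 1} and R = {0, a} each has
-- (s+1)(d+1) elements, so it increases with sd. Equal sums and equal products give equal pairs.
module Submission where

open import Defs
open import Data.Nat using (ℕ; zero; suc; _+_; _*_; _∸_; _≤_; _<_; _≥_; _>_; z≤n; s≤s; _≤?_)
open import Data.Nat.Properties
open import Data.Nat.Tactic.RingSolver using (solve-∀)
open import Data.Integer as ℤ using (_⊖_) renaming (+_ to pos)
import Data.Integer.Properties as ℤ
open import Data.Product using (_×_; Σ; ∃; ∃₂; _,_; proj₁; proj₂)
open import Data.Sum using (_⊎_; inj₁; inj₂)
open import Data.List using (List; []; _∷_; _++_; map; length; replicate; upTo)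
open import Data.Nat.ListAction using (sum)
open import Data.List.Properties using (length-++; length-map; length-upTo)
open import Data.List.Membership.Propositional using (_∈_)
open import Data.List.Membership.Propositional.Properties
open import Data.List.Membership.Propositional.Properties.WithK using (unique∧set⇒bag)
open import Data.List.Relation.Binary.BagAndSetEquality using (∼bag⇒↭)
open import Data.List.Relation.Binary.Permutation.Propositional.Properties using (↭-length)
open import Data.List.Relation.Unary.All using (All; []; _∷_)
import Data.List.Relation.Unary.All.Properties as All
open import Data.List.Relation.Unary.Any using (here; there)
open import Data.List.Relation.Unary.Unique.Propositional using (Unique)
import Data.List.Relation.Unary.Unique.Propositional.Properties as Unique
open import Data.List.Relation.Unary.Unique.DecPropositional.Properties _≟P_ using (deduplicate-!)
open import Function using (_∘_; mk⇔)
open import Relation.Binary.PropositionalEquality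
open import Relation.Binary.Definitions using (tri<; tri≈; tri>)
open import Relation.Nullary using (¬_; yes; no; contradiction)

-- Cardinalities and differences of naturals as integers.

-- Duplicate-free lists with the same members are permutations of each other, so any duplicate-free
-- listing of a set computes its `card`.
card-unique : ∀ {xs ys} → Unique ys → (∀ {p} → p ∈ xs → p ∈ ys) → (∀ {p} → p ∈ ys → p ∈ xs) →
  card xs ≡ length ys
card-unique {xs} !ys xs⊆ys ys⊆xs = ↭-length (∼bag⇒↭ (unique∧set⇒bag (deduplicate-! xs) !ys
  (mk⇔ (xs⊆ys ∘ ∈-deduplicate⁻ _≟P_ xs) (∈-deduplicate⁺ _≟P_ ∘ ys⊆xs))))

⊖-injective : ∀ a b c d → a ⊖ b ≡ c ⊖ d → a + d ≡ c + b
⊖-injective a b c d eq = ℤ.+-injective (begin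
  pos (a + d)             ≡⟨ collect a b d ⟩
  (a ⊖ b) ℤ.+ pos (b + d) ≡⟨ cong₂ ℤ._+_ eq (cong pos (+-comm b d)) ⟩
  (c ⊖ d) ℤ.+ pos (d + b) ≡⟨ collect c d b ⟨
  pos (c + b)             ∎)
  where
  open ≡-Reasoning
  collect : ∀ a b d → pos (a + d) ≡ (a ⊖ b) ℤ.+ pos (b + d)
  collect a b d = sym (begin
    (a ⊖ b) ℤ.+ pos (b + d) ≡⟨ ℤ.distribˡ-⊖-+-pos (b + d) a b ⟩
    (a + (b + d)) ⊖ b       ≡⟨ cong₂ _⊖_ (swap a b d) (sym (+-identityʳ b)) ⟩
    (b + (a + d)) ⊖ (b + 0) ≡⟨ ℤ.+-cancelˡ-⊖ b (a + d) 0 ⟩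
    pos (a + d)             ∎)
    where
    swap : ∀ a b d → a + (b + d) ≡ b + (a + d)
    swap = solve-∀

⊖-cong : ∀ a b c d → a + d ≡ c + b → a ⊖ b ≡ c ⊖ d
⊖-cong a b c d eq = begin
  a ⊖ b             ≡⟨ ℤ.+-cancelˡ-⊖ d a b ⟨
  (d + a) ⊖ (d + b) ≡⟨ cong₂ _⊖_ (trans (+-comm d a) (trans eq (+-comm c b))) (+-comm d b) ⟩
  (b + c) ⊖ (b + d) ≡⟨ ℤ.+-cancelˡ-⊖ b c d ⟩
  c ⊖ d             ∎
  where open ≡-Reasoning

-- Fringe sumsets and intervals with two fringes.

record Enumerates (P : ℕ → Set) (xs : List ℕ) : Set where
  field
    unique   : Unique xs
    sound    : ∀ {x} → x ∈ xs → P x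
    complete : ∀ {x} → P x → x ∈ xs
open Enumerates

-- The set sL + dR. Summands from `L` and `R` may come in any order, which makes exchanging the two
-- lists a structural recursion.
data Sumset (L R : List ℕ) : ℕ → ℕ → ℕ → Set where
  nil   : Sumset L R 0 0 0
  left  : ∀ {x s d t} → x ∈ L → Sumset L R s d t → Sumset L R (suc s) d (x + t)
  right : ∀ {y s d t} → y ∈ R → Sumset L R s d t → Sumset L R s (suc d) (y + t)

Sumset-swap : ∀ {L R s d t} → Sumset L R s d t → Sumset R L d s t
Sumset-swap nil         = nil
Sumset-swap (left x u)  = right x (Sumset-swap u)
Sumset-swap (right y u) = left y (Sumset-swap u)

-- A value x of the interval [0, x + x′] is written as the pair (x , x′) of its distances to the
-- two ends, so that reversing the interval is just exchanging the components.
data Fringed (K : ℕ) (X Y : ℕ → Set) (x x′ : ℕ) : Set where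
  lower  : X x → Fringed K X Y x x′
  middle : K ≤ x → K ≤ x′ → Fringed K X Y x x′
  upper  : Y x′ → Fringed K X Y x x′

-- The total is at least 4K, so a value within K of one end is at least 3K away from the other.
far-end : ∀ {K u v} k → u + v ≡ suc k * (4 * K) → v ≤ K → K ≤ u
far-end {K} {u} {v} k eq v≤K = +-cancelʳ-≤ v K u (begin
  K + v                                 ≤⟨ +-monoʳ-≤ K v≤K ⟩
  K + K                                 ≤⟨ m≤m+n (K + K) (2 * K + k * (4 * K)) ⟩
  (K + K) + (2 * K + k * (4 * K))       ≡⟨ regroup K k ⟩
  suc k * (4 * K)                       ≡⟨ eq ⟨
  u + v                                 ∎)
  where
  open ≤-Reasoning
  regroup : ∀ K k → (K + K) + (2 * K + k * (4 * K)) ≡ suc k * (4 * K)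
  regroup = solve-∀

three-quarters : ∀ K t t′ → t + t′ ≡ 2 * (4 * K) → ¬ (4 * K + K ≤ t′) → ∃ λ r → 3 * K + r ≡ t
three-quarters K t t′ e t′≱ = m≤n⇒∃[o]m+o≡n (+-cancelʳ-≤ (4 * K + K) (3 * K) t (begin
  3 * K + (4 * K + K) ≡⟨ regroup K ⟩
  2 * (4 * K)         ≡⟨ e ⟨
  t + t′              ≤⟨ +-monoʳ-≤ t (<⇒≤ (≰⇒> t′≱)) ⟩
  t + (4 * K + K)     ∎))
  where
  open ≤-Reasoning
  regroup : ∀ K → 3 * K + (4 * K + K) ≡ 2 * (4 * K)
  regroup = solve-∀

-- Sums and differences of a fringed interval stay fringed.

-- `a` bounds the elements of the fringes and `h` the number of summands, so `h*a<K` keeps every sum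
-- of fringe elements out of the middle part.
module Construction (h a K : ℕ) (h*a<K : h * a < K) (a≤K : a ≤ K) where
  n : ℕ
  n = 4 * K

  Bounded : List ℕ → Set
  Bounded L = ∀ {x} → x ∈ L → x ≤ a

  Sumset-≤ : ∀ {L R s d t} → Bounded L → Bounded R → Sumset L R s d t → t ≤ (s + d) * a
  Sumset-≤ bL bR nil = z≤n
  Sumset-≤ bL bR (left x u) = +-mono-≤ (bL x) (Sumset-≤ bL bR u)
  Sumset-≤ {s = s} {suc d} bL bR (right y u) rewrite +-suc s d =
    +-mono-≤ (bR y) (Sumset-≤ bL bR u)

  Sumset-< : ∀ {L R s d t} → Bounded L → Bounded R → s + d ≤ h → Sumset L R s d t → t < K
  Sumset-< bL bR s+d≤h u =
    ≤-<-trans (≤-trans (Sumset-≤ bL bR u) (*-monoˡ-≤ a s+d≤h)) h*a<K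

  Summand : (L R : List ℕ) → ℕ → ℕ → Set
  Summand L R x x′ = x + x′ ≡ n × Fringed K (_∈ L) (_∈ R) x x′

  Summand-flip : ∀ {L R x x′} → Summand L R x x′ → Summand R L x′ x
  Summand-flip {x = x} {x′} (e , lower p)    = trans (+-comm x′ x) e , upper p
  Summand-flip {x = x} {x′} (e , middle p q) = trans (+-comm x′ x) e , middle q p
  Summand-flip {x = x} {x′} (e , upper q)    = trans (+-comm x′ x) e , lower q

  -- A summand x is subtracted by adding n − x, so t here is the actual value plus d * n.
  data Sums (L R : List ℕ) : ℕ → ℕ → ℕ → ℕ → Set where
    nil   : Sums L R 0 0 0 0
    plus  : ∀ {x x′ s d t t′} → Summand L R x x′ → Sums L R s d t t′ →
            Sums L R (suc s) d (x + t) (x′ + t′)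
    minus : ∀ {x x′ s d t t′} → Summand L R x x′ → Sums L R s d t t′ →
            Sums L R s (suc d) (x′ + t) (x + t′)

  Sums-flip : ∀ {L R s d t t′} → Sums L R s d t t′ → Sums R L s d t′ t
  Sums-flip nil         = nil
  Sums-flip (plus p S)  = plus (Summand-flip p) (Sums-flip S)
  Sums-flip (minus p S) = minus (Summand-flip p) (Sums-flip S)

  -- Reversing the base set exchanges `L` and `R`, so the upper fringe of the sumset is the mirror
  -- image of sR + dL.
  FringedSum : (L R : List ℕ) (s d t t′ : ℕ) → Set
  FringedSum L R s d t t′ =
    t + t′ ≡ (s + d) * n × Fringed K (Sumset L R s d) (Sumset R L s d) t t′

  FringedSum-swap : ∀ {L R s d t t′} → FringedSum L R s d t t′ → FringedSum R L d s t t′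
  FringedSum-swap {s = s} {d} (e , lower u) =
    trans e (cong (_* n) (+-comm s d)) , lower (Sumset-swap u)
  FringedSum-swap {s = s} {d} (e , middle p q) =
    trans e (cong (_* n) (+-comm s d)) , middle p q
  FringedSum-swap {s = s} {d} (e , upper u) =
    trans e (cong (_* n) (+-comm s d)) , upper (Sumset-swap u)

  add-total : ∀ x x′ t t′ {m} → x + x′ ≡ n → t + t′ ≡ m → (x + t) + (x′ + t′) ≡ n + m
  add-total x x′ t t′ e e′ = trans (regroup x x′ t t′) (cong₂ _+_ e e′)
    where
    regroup : ∀ x x′ t t′ → (x + t) + (x′ + t′) ≡ (x + x′) + (t + t′)
    regroup = solve-∀

  module _ {L R : List ℕ} (bL : Bounded L) (bR : Bounded R) where

    -- With at least one summand, `far-end` applies because `t` is below `K`. The empty sum is the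
    -- exception: its interval has length 0 and both distances vanish.
    opposite : ∀ {s d t t′} → s + d ≤ h → t + t′ ≡ (s + d) * n → Sumset L R s d t →
               (s ≡ 0 × d ≡ 0 × t ≡ 0 × t′ ≡ 0) ⊎ K ≤ t′
    opposite {zero} {zero} {t} _ e _ = inj₁ (refl , refl , m+n≡0⇒m≡0 t e , m+n≡0⇒n≡0 t e)
    opposite {zero} {suc d} {t} {t′} b e u =
      inj₂ (far-end d (trans (+-comm t′ t) e) (<⇒≤ (Sumset-< bL bR b u)))
    opposite {suc s} {d} {t} {t′} b e u =
      inj₂ (far-end (s + d) (trans (+-comm t′ t) e) (<⇒≤ (Sumset-< bL bR b u)))

    opposite₁ : ∀ {x x′} → x + x′ ≡ n → x ∈ L → K ≤ x′
    opposite₁ {x} {x′} e p =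
      far-end 0 (trans (+-comm x′ x) (trans e (sym (+-identityʳ n)))) (≤-trans (bL p) a≤K)

  -- Distances to the two ends add up. A middle term therefore makes the result middle, and fringe
  -- terms at the same end stay in the fringe. For fringe terms at opposite ends, each is far from
  -- the end that the other is close to, so the result is middle.
  FringedSum-plus : ∀ {L R x x′ s d t t′} → Bounded L → Bounded R → s + d ≤ h →
    Summand L R x x′ → FringedSum L R s d t t′ → FringedSum L R (suc s) d (x + t) (x′ + t′)
  FringedSum-plus {L} {R} {x} {x′} {s} {d} {t} {t′} bL bR b (e , f) (e′ , g) =
    add-total x x′ t t′ e e′ , fringed f g
    where
    flip-e : x′ + x ≡ n
    flip-e = trans (+-comm x′ x) e
    flip-e′ : t′ + t ≡ (s + d) * n
    flip-e′ = trans (+-comm t′ t) e′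

    fringed : Fringed K (_∈ L) (_∈ R) x x′ → Fringed K (Sumset L R s d) (Sumset R L s d) t t′ →
              Fringed K (Sumset L R (suc s) d) (Sumset R L (suc s) d) (x + t) (x′ + t′)
    fringed (middle p q) _ = middle (m≤n⇒m≤n+o t p) (m≤n⇒m≤n+o t′ q)
    fringed _ (middle p q) = middle (m≤n⇒m≤o+n x p) (m≤n⇒m≤o+n x′ q)
    fringed (lower p) (lower u) = lower (left p u)
    fringed (upper p) (upper u) = upper (left p u)
    fringed (lower p) (upper u) with opposite bR bL b flip-e′ u
    -- The empty sum belongs to both fringes; the result is then the new summand alone.
    ... | inj₁ (refl , refl , _ , refl) = lower (left p nil)
    ... | inj₂ K≤t = middle (m≤n⇒m≤o+n x K≤t) (m≤n⇒m≤n+o t′ (opposite₁ bL bR e p))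
    fringed (upper p) (lower u) with opposite bL bR b e′ u
    ... | inj₁ (refl , refl , _ , refl) = upper (left p nil)
    ... | inj₂ K≤t′ = middle (m≤n⇒m≤n+o t (opposite₁ bR bL flip-e p)) (m≤n⇒m≤o+n x′ K≤t′)

  Sums⇒FringedSum : ∀ {L R s d t t′} → Bounded L → Bounded R → s + d ≤ h →
    Sums L R s d t t′ → FringedSum L R s d t t′
  Sums⇒FringedSum bL bR b nil = refl , lower nil
  Sums⇒FringedSum bL bR b (plus p S) =
    FringedSum-plus bL bR (<⇒≤ b) p (Sums⇒FringedSum bL bR (<⇒≤ b) S)
  Sums⇒FringedSum {s = s} {suc d} bL bR b (minus p S) =
    -- Subtracting an element amounts to adding one of the reversed base set: swap the roles of the
    -- lists, add, and swap back.
    FringedSum-swap (FringedSum-plus bR bL (subst (_≤ h) (+-comm s d) b′) (Summand-flip p)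
      (FringedSum-swap (Sums⇒FringedSum bL bR b′ S)))
    where
    b′ : s + d ≤ h
    b′ = <⇒≤ (subst (_≤ h) (+-suc s d) b)

  Sums-total : ∀ {L R s d t t′} → Sums L R s d t t′ → t + t′ ≡ (s + d) * n
  Sums-total nil = refl
  Sums-total (plus {x} {x′} {t = t} {t′} (e , _) S) = add-total x x′ t t′ e (Sums-total S)
  Sums-total {s = s} {suc d} (minus {x} {x′} {t = t} {t′} (e , _) S) =
    trans (add-total x′ x t t′ (trans (+-comm x′ x) e) (Sums-total S)) (cong (_* n) (sym (+-suc s d)))

  -- Every middle value and every fringe value is attained.

  -- Both x and n - x lie in the base set, so adding the former or subtracting the latter
  -- contributes the same pair of distances. Such a summand can be used with either sign.
  Symmetric : (L R : List ℕ) → ℕ → ℕ → Set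
  Symmetric L R x x′ = Summand L R x x′ × Summand L R x′ x

  module _ {L R : List ℕ} (0∈L : 0 ∈ L) (0∈R : 0 ∈ R) where
    zero-end : Symmetric L R n 0
    zero-end = (+-identityʳ n , upper 0∈R) , (refl , lower 0∈L)

  Symmetric-flip : ∀ {L R x x′} → Symmetric L R x x′ → Symmetric L R x′ x
  Symmetric-flip (p , q) = q , p

  symmetric-step : ∀ {L R m x x′ t t′} → Symmetric L R x x′ →
    (∀ s d → s + d ≡ m → Sums L R s d t t′) →
    ∀ s d → s + d ≡ suc m → Sums L R s d (x + t) (x′ + t′)
  symmetric-step (p , q) S zero    (suc d) e = minus q (S zero d (suc-injective e))
  symmetric-step (p , q) S (suc s) d       e = plus p (S s d (suc-injective e))

  module _ {L R : List ℕ} (bL : Bounded L) (bR : Bounded R) (0∈L : 0 ∈ L) (0∈R : 0 ∈ R) where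

    middle⇒Sums₁ : ∀ {t t′} → K ≤ t → K ≤ t′ → t + t′ ≡ n →
      ∀ s d → s + d ≡ 1 → Sums L R s d t t′
    middle⇒Sums₁ {t} {t′} p q e s d es =
      subst₂ (Sums L R s d) (+-identityʳ t) (+-identityʳ t′)
        (symmetric-step {m = 0} ((e , middle p q) , (trans (+-comm t′ t) e , middle q p)) nils s d es)
      where
      nils : ∀ s d → s + d ≡ 0 → Sums L R s d 0 0
      nils zero zero _ = nil

    -- Induction on the number of summands, using symmetric summands only so that the signs do not
    -- matter. If one distance is at least n + K, the summand n or 0 is split off and the rest is
    -- still middle.
    middle⇒Sums : ∀ m {t t′} → K ≤ t → K ≤ t′ → t + t′ ≡ suc m * n →
      ∀ s d → s + d ≡ suc m → Sums L R s d t t′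
    middle⇒Sums zero p q e = middle⇒Sums₁ p q (trans e (+-identityʳ n))
    middle⇒Sums (suc m) {t} {t′} p q e s d es with n + K ≤? t | n + K ≤? t′
    ... | yes n+K≤t | _ with u , refl ← m≤n⇒∃[o]m+o≡n n+K≤t =
      subst (λ z → Sums L R s d z t′) (sym (+-assoc n K u))
        (symmetric-step (zero-end 0∈L 0∈R)
          (middle⇒Sums m (m≤m+n K u) q (+-cancelˡ-≡ n _ _ (trans (regroup n K u t′) e))) s d es)
      where
      regroup : ∀ n K u t′ → n + ((K + u) + t′) ≡ n + K + u + t′
      regroup = solve-∀
    ... | no _ | yes n+K≤t′ with u , refl ← m≤n⇒∃[o]m+o≡n n+K≤t′ =
      subst (Sums L R s d t) (sym (+-assoc n K u))
        (symmetric-step (Symmetric-flip (zero-end 0∈L 0∈R))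
          (middle⇒Sums m p (m≤m+n K u) (+-cancelˡ-≡ n _ _ (trans (regroup n K u t) e))) s d es)
      where
      regroup : ∀ n K u t → n + (t + (K + u)) ≡ t + (n + K + u)
      regroup = solve-∀
    middle⇒Sums (suc (suc m)) {t} {t′} p q e s d es | no t≱ | no t′≱ =
      -- With three or more summands the total is at least 12K, but both distances are below n + K =
      -- 5K.
      contradiction e (<⇒≢ (begin-strict
        t + t′                       <⟨ +-mono-< (≰⇒> t≱) (≰⇒> t′≱) ⟩
        (n + K) + (n + K)            ≤⟨ m≤m+n _ (2 * K + m * n) ⟩
        (n + K) + (n + K) + (2 * K + m * n) ≡⟨ regroup K m ⟩
        suc (suc (suc m)) * n        ∎))
      where
      open ≤-Reasoning
      regroup : ∀ K m → (4 * K + K) + (4 * K + K) + (2 * K + m * (4 * K)) ≡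
                suc (suc (suc m)) * (4 * K)
      regroup = solve-∀
    middle⇒Sums (suc zero) {t} {t′} p q e s d es | no t≱ | no t′≱
      with r , refl ← three-quarters K t t′ e t′≱
         | r′ , refl ← three-quarters K t′ t (trans (+-comm t′ t) e) t≱ =
      -- With two summands the total is 8K and both distances are at least 3K. Splitting off the
      -- midpoint 2K of [0, n] leaves distances at least K.
      subst₂ (Sums L R s d) (split K r) (split K r′)
        (symmetric-step
          ((e₁ , middle (m≤m+n K r) (m≤m+n K r′)) ,
           (trans (+-comm (K + r′) (K + r)) e₁ , middle (m≤m+n K r′) (m≤m+n K r)))
          (middle⇒Sums₁ (m≤m+n K (1 * K)) (m≤m+n K (1 * K)) (double K)) s d es)
      where
      split : ∀ K r → (K + r) + 2 * K ≡ 3 * K + r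
      split = solve-∀
      double : ∀ K → 2 * K + 2 * K ≡ 4 * K
      double = solve-∀
      e₁ : (K + r) + (K + r′) ≡ n
      e₁ = +-cancelʳ-≡ n _ _ (trans (regroup K r r′) (trans e (two K)))
        where
        regroup : ∀ K r r′ → (K + r) + (K + r′) + (4 * K) ≡ (3 * K + r) + (3 * K + r′)
        regroup = solve-∀
        two : ∀ K → 2 * (4 * K) ≡ 4 * K + 4 * K
        two = solve-∀

  complement : ∀ {x} → x ≤ a → x + (n ∸ x) ≡ n
  complement x≤a = m+[n∸m]≡n (≤-trans x≤a (≤-trans a≤K (m≤n*m K 4)))

  module _ {L R : List ℕ} (bL : Bounded L) (bR : Bounded R) where

    -- An x in `L` is added as itself; a y in `R` arises by subtracting n - y, which lies in the
    -- upper fringe of the base set.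
    lower⇒Sums : ∀ {s d t} → Sumset L R s d t → ∃ λ t′ → Sums L R s d t t′
    lower⇒Sums nil = 0 , nil
    lower⇒Sums (left {x} p u) with t′ , S ← lower⇒Sums u =
      n ∸ x + t′ , plus (complement (bL p) , lower p) S
    lower⇒Sums (right {y} p u) with t′ , S ← lower⇒Sums u =
      n ∸ y + t′ , minus (trans (+-comm (n ∸ y) y) (complement (bR p)) , upper p) S

  -- The set of lattice points and the cardinality of sA - dA.

  -- The interval [K, (m + 1)n - K]. Its length is (m + 1)n - 2K = 2K + mn, since n = 4K.
  core : ℕ → List ℕ
  core m = map (K +_) (upTo (suc (2 * K + m * n)))

  core-total : ∀ m i j → (K + i) + (K + j) ≡ suc m * n → i + j ≡ 2 * K + m * n
  core-total m i j e = +-cancelˡ-≡ (2 * K) _ _ (trans (sym (regroup K i j)) (trans e (split K m)))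
    where
    regroup : ∀ K i j → (K + i) + (K + j) ≡ 2 * K + (i + j)
    regroup = solve-∀
    split : ∀ K m → suc m * (4 * K) ≡ 2 * K + (2 * K + m * (4 * K))
    split = solve-∀

  core-total⁻ : ∀ m i j → i + j ≡ 2 * K + m * n → (K + i) + (K + j) ≡ suc m * n
  core-total⁻ m i j e = trans (regroup K i j) (trans (cong (2 * K +_) e) (split K m))
    where
    regroup : ∀ K i j → (K + i) + (K + j) ≡ 2 * K + (i + j)
    regroup = solve-∀
    split : ∀ K m → 2 * K + (2 * K + m * (4 * K)) ≡ suc m * (4 * K)
    split = solve-∀

  ∈-core⁺ : ∀ m {t t′} → K ≤ t → K ≤ t′ → t + t′ ≡ suc m * n → t ∈ core m
  ∈-core⁺ m p q e with i , refl ← m≤n⇒∃[o]m+o≡n p | j , refl ← m≤n⇒∃[o]m+o≡n q =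
    ∈-map⁺ (K +_) (∈-upTo⁺ (s≤s (≤-trans (m≤m+n i j) (≤-reflexive (core-total m i j e)))))

  ∈-core⁻ : ∀ m {t} → t ∈ core m → K ≤ t × ∃ λ t′ → K ≤ t′ × t + t′ ≡ suc m * n
  ∈-core⁻ m t∈ with i , i∈ , refl ← ∈-map⁻ (K +_) t∈
                with j , e ← m≤n⇒∃[o]m+o≡n (≤-pred (∈-upTo⁻ i∈)) =
    m≤m+n K i , K + j , m≤m+n K j , core-total⁻ m i j e

  point : ℕ → Point
  point x = pos x , pos 0

  base : (L R : List ℕ) → List Point
  base L R = map point (L ++ core 0 ++ map (n ∸_) R)

  module _ {L R : List ℕ} (bL : Bounded L) (bR : Bounded R) where

    ∈-base⁻ : ∀ {p} → p ∈ base L R → ∃₂ λ x x′ → Summand L R x x′ × p ≡ point x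
    ∈-base⁻ p∈ with x , x∈ , refl ← ∈-map⁻ point p∈ with ∈-++⁻ L x∈
    ... | inj₁ x∈L = x , n ∸ x , (complement (bL x∈L) , lower x∈L) , refl
    ... | inj₂ x∈core++R with ∈-++⁻ (core 0) x∈core++R
    ...   | inj₁ x∈core with p , x′ , q , e ← ∈-core⁻ 0 x∈core =
      x , x′ , (trans e (+-identityʳ n) , middle p q) , refl
    ...   | inj₂ x∈R with y , y∈R , refl ← ∈-map⁻ (n ∸_) x∈R =
      n ∸ y , y , (trans (+-comm (n ∸ y) y) (complement (bR y∈R)) , upper y∈R) , refl

    ∈-base⁺ : ∀ {x x′} → Summand L R x x′ → point x ∈ base L R
    ∈-base⁺ (_ , lower x∈L) = ∈-map⁺ point (∈-++⁺ˡ x∈L)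
    ∈-base⁺ (e , middle p q) =
      ∈-map⁺ point (∈-++⁺ʳ L (∈-++⁺ˡ (∈-core⁺ 0 p q (trans e (sym (+-identityʳ n))))))
    ∈-base⁺ {x} {x′} (e , upper x′∈R) = ∈-map⁺ point (∈-++⁺ʳ L (∈-++⁺ʳ (core 0)
      (subst (_∈ map (n ∸_) R) (trans (cong (_∸ x′) (sym e)) (m+n∸n≡m x x′)) (∈-map⁺ (n ∸_) x′∈R))))

    ∈-fold⁻ : ∀ s {q} → q ∈ fold s (base L R) → ∃₂ λ u u′ → Sums L R s 0 u u′ × q ≡ point u
    ∈-fold⁻ zero    (here refl) = 0 , 0 , nil , refl
    ∈-fold⁻ (suc s) q∈
      with p , q , p∈ , q∈ , refl ← ∈-cartesianProductWith⁻ _+P_ (base L R) (fold s (base L R)) q∈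
      with x , x′ , X , refl ← ∈-base⁻ p∈
      with u , u′ , S , refl ← ∈-fold⁻ s q∈ = x + u , x′ + u′ , plus X S , refl

    ∈-fold⁺ : ∀ {s u u′} → Sums L R s 0 u u′ → point u ∈ fold s (base L R)
    ∈-fold⁺ nil        = here refl
    ∈-fold⁺ (plus X S) = ∈-cartesianProductWith⁺ _+P_ (∈-base⁺ X) (∈-fold⁺ S)

  Sums-merge : ∀ {L R s d u u′ v v′} → Sums L R s 0 u u′ → Sums L R d 0 v v′ →
    Sums L R s d (v′ + u) (v + u′)
  Sums-merge S nil = S
  Sums-merge {u = u} {u′} S (plus {x} {x′} {t = v} {v′} X T) =
    subst₂ (Sums _ _ _ _) (sym (+-assoc x′ v′ u)) (sym (+-assoc x v u′)) (minus X (Sums-merge S T))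

  -- `Sums` mixes the signs while `sumDiff` subtracts one sum from another. The subtracted elements
  -- are collected into a positive sum, whose distance `v′` to the right end is what enters the
  -- total.
  record Separated (L R : List ℕ) (s d t : ℕ) : Set where
    constructor separated
    field
      {u u′ v v′} : ℕ
      positive    : Sums L R s 0 u u′
      negative    : Sums L R d 0 v v′
      total       : t ≡ v′ + u

  Sums-separate : ∀ {L R s d t t′} → Sums L R s d t t′ → Separated L R s d t
  Sums-separate nil = separated nil nil refl
  Sums-separate (plus {x} X S) with separated {u} {v′ = v′} P N refl ← Sums-separate S =
    separated (plus X P) N (regroup x v′ u)
    where
    regroup : ∀ x v′ u → x + (v′ + u) ≡ v′ + (x + u)
    regroup = solve-∀
  Sums-separate (minus {x′ = x′} X S) with separated {u} {v′ = v′} P N refl ← Sums-separate S =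
    separated P (plus X N) (sym (+-assoc x′ v′ u))

  -- The set sA - dA lies in [-dn, sn]; these are the points at a given distance from its left end
  -- and from its right end.
  shifted reflected : ℕ → ℕ → Point
  shifted d t = t ⊖ d * n , pos 0
  reflected s t = s * n ⊖ t , pos 0

  difference-shifted : ∀ {L R d u v v′} → Sums L R d 0 v v′ → point u -P point v ≡ shifted d (v′ + u)
  difference-shifted {d = d} {u} {v} {v′} S = cong (_, pos 0) (trans (ℤ.m-n≡m⊖n u v)
    (⊖-cong u v (v′ + u) (d * n) (begin
      u + d * n       ≡⟨ cong (λ m → u + m * n) (+-identityʳ d) ⟨
      u + (d + 0) * n ≡⟨ cong (u +_) (Sums-total S) ⟨
      u + (v + v′)    ≡⟨ regroup u v v′ ⟩
      v′ + u + v      ∎)))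
    where
    open ≡-Reasoning
    regroup : ∀ u v v′ → u + (v + v′) ≡ v′ + u + v
    regroup = solve-∀

  module _ {L R : List ℕ} (bL : Bounded L) (bR : Bounded R) where

    ∈-sumDiff⁻ : ∀ s d {p} → p ∈ sumDiff s d (base L R) →
      ∃₂ λ t t′ → Sums L R s d t t′ × p ≡ shifted d t
    ∈-sumDiff⁻ s d p∈
      with q , r , q∈ , r∈ , refl ← ∈-cartesianProductWith⁻ _-P_ (fold s (base L R)) (fold d (base L R)) p∈
      with u , u′ , S , refl ← ∈-fold⁻ bL bR s q∈
      with v , v′ , T , refl ← ∈-fold⁻ bL bR d r∈ =
      v′ + u , v + u′ , Sums-merge S T , difference-shifted T

    ∈-sumDiff⁺ : ∀ {s d t t′} → Sums L R s d t t′ → shifted d t ∈ sumDiff s d (base L R)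
    ∈-sumDiff⁺ {s} {d} S with separated P N refl ← Sums-separate S =
      subst (_∈ sumDiff s d (base L R)) (difference-shifted N)
        (∈-cartesianProductWith⁺ _-P_ (∈-fold⁺ bL bR P) (∈-fold⁺ bL bR N))

  reflected≡shifted : ∀ {s d t t′} → t + t′ ≡ (s + d) * n → reflected s t′ ≡ shifted d t
  reflected≡shifted {s} {d} {t} {t′} e = cong (_, pos 0) (⊖-cong (s * n) t′ t (d * n)
    (trans (sym (*-distribʳ-+ n s d)) (sym e)))

  reflected≡shifted⁻ : ∀ {s d t t′} → reflected s t′ ≡ shifted d t → t + t′ ≡ (s + d) * n
  reflected≡shifted⁻ {s} {d} {t} {t′} e =
    sym (trans (*-distribʳ-+ n s d) (⊖-injective (s * n) t′ t (d * n) (cong proj₁ e)))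

  shifted-injective : ∀ d {t u} → shifted d t ≡ shifted d u → t ≡ u
  shifted-injective d {t} {u} e =
    +-cancelʳ-≡ (d * n) t u (⊖-injective t (d * n) u (d * n) (cong proj₁ e))

  reflected-injective : ∀ s {t u} → reflected s t ≡ reflected s u → t ≡ u
  reflected-injective s {t} {u} e =
    +-cancelˡ-≡ (s * n) t u (sym (⊖-injective (s * n) t (s * n) u (cong proj₁ e)))

  -- The lower fringe has distance below `K` to the left end, the upper fringe to the right end, and
  -- `core` is everything at distance at least `K` from both. The three pieces are thus disjoint,
  -- and their lengths add up.
  card-sumDiff : ∀ {L R X Y m s d} → Bounded L → Bounded R → 0 ∈ L → 0 ∈ R →
    s + d ≡ suc m → s + d ≤ h →
    Enumerates (Sumset L R s d) X → Enumerates (Sumset R L s d) Y →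
    card (sumDiff s d (base L R)) ≡ length X + length Y + suc (2 * K + m * n)
  card-sumDiff {L} {R} {X} {Y} {m} {s} {d} bL bR 0∈L 0∈R es b eX eY =
    trans (card-unique {sumDiff s d (base L R)} unique-points sumDiff⊆points points⊆sumDiff) length-points
    where
    points : List Point
    points = map (shifted d) (X ++ core m) ++ map (reflected s) Y

    to-suc-m : ∀ {t t′} → t + t′ ≡ (s + d) * n → t + t′ ≡ suc m * n
    to-suc-m e = trans e (cong (_* n) es)

    unique-points : Unique points
    unique-points = Unique.++⁺
      (Unique.map⁺ (shifted-injective d)
        (Unique.++⁺ (unique eX) (Unique.map⁺ (+-cancelˡ-≡ K _ _) (Unique.upTo⁺ _))
          λ (t∈X , t∈core) →
            <⇒≱ (Sumset-< bL bR b (sound eX t∈X)) (proj₁ (∈-core⁻ m t∈core))))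
      (Unique.map⁺ (reflected-injective s) (unique eY))
      disjoint
      where
      disjoint : ∀ {p} → ¬ (p ∈ map (shifted d) (X ++ core m) × p ∈ map (reflected s) Y)
      disjoint (p∈ , p∈′)
        with t , t∈ , refl ← ∈-map⁻ (shifted d) p∈
        with t′ , t′∈ , e ← ∈-map⁻ (reflected s) p∈′
        with e′ ← to-suc-m {t} {t′} (reflected≡shifted⁻ {s} {d} (sym e))
        with t′<K ← Sumset-< bR bL b (sound eY t′∈)
        with ∈-++⁻ X t∈
      ... | inj₁ t∈X = <⇒≱ (Sumset-< bL bR b (sound eX t∈X)) (far-end m e′ (<⇒≤ t′<K))
      ... | inj₂ t∈core with _ , t″ , K≤t″ , e″ ← ∈-core⁻ m t∈core
                        with refl ← +-cancelˡ-≡ t t″ t′ (trans e″ (sym e′)) = <⇒≱ t′<K K≤t″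

    sumDiff⊆points : ∀ {p} → p ∈ sumDiff s d (base L R) → p ∈ points
    sumDiff⊆points p∈ with t , t′ , S , refl ← ∈-sumDiff⁻ bL bR s d p∈
                      with Sums⇒FringedSum bL bR b S
    ... | _ , lower u    = ∈-++⁺ˡ (∈-map⁺ (shifted d) (∈-++⁺ˡ (complete eX u)))
    ... | e , middle p q = ∈-++⁺ˡ (∈-map⁺ (shifted d) (∈-++⁺ʳ X (∈-core⁺ m p q (to-suc-m {t} {t′} e))))
    ... | e , upper u    = ∈-++⁺ʳ _ (subst (_∈ map (reflected s) Y) (reflected≡shifted {s} {d} {t} {t′} e)
                             (∈-map⁺ (reflected s) (complete eY u)))

    points⊆sumDiff : ∀ {p} → p ∈ points → p ∈ sumDiff s d (base L R)
    points⊆sumDiff p∈ with ∈-++⁻ (map (shifted d) (X ++ core m)) p∈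
    -- The upper fringe is attained as the lower fringe of the reversed base set, then flipped back.
    ... | inj₂ p∈Y with t′ , t′∈ , refl ← ∈-map⁻ (reflected s) p∈Y
                   with t , S ← lower⇒Sums bR bL (sound eY t′∈) =
      subst (_∈ sumDiff s d (base L R))
        (sym (reflected≡shifted {s} {d} {t} {t′} (trans (+-comm t t′) (Sums-total S))))
        (∈-sumDiff⁺ bL bR (Sums-flip S))
    ... | inj₁ p∈XC with t , t∈ , refl ← ∈-map⁻ (shifted d) p∈XC with ∈-++⁻ X t∈
    ...   | inj₁ t∈X with t′ , S ← lower⇒Sums bL bR (sound eX t∈X) = ∈-sumDiff⁺ bL bR S
    ...   | inj₂ t∈core with p , t′ , q , e ← ∈-core⁻ m t∈core =
      ∈-sumDiff⁺ bL bR (middle⇒Sums bL bR 0∈L 0∈R m p q e s d es)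

    length-points : length points ≡ length X + length Y + suc (2 * K + m * n)
    length-points = begin
      length points
        ≡⟨ length-++ (map (shifted d) (X ++ core m)) ⟩
      length (map (shifted d) (X ++ core m)) + length (map (reflected s) Y)
        ≡⟨ cong₂ _+_ (length-map (shifted d) (X ++ core m)) (length-map (reflected s) Y) ⟩
      length (X ++ core m) + length Y
        ≡⟨ cong (_+ length Y) (length-++ X) ⟩
      length X + length (core m) + length Y
        ≡⟨ cong (λ l → length X + l + length Y)
             (trans (length-map (K +_) (upTo (suc (2 * K + m * n)))) (length-upTo _)) ⟩
      length X + suc (2 * K + m * n) + length Y
        ≡⟨ regroup (length X) _ (length Y) ⟩
      length X + length Y + suc (2 * K + m * n) ∎
      where
      open ≡-Reasoning
      regroup : ∀ x m y → x + m + y ≡ x + y + m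
      regroup = solve-∀

  base-nonempty : ∀ {L R} → 0 ∈ L → base L R ≢ []
  base-nonempty 0∈L e with () ← subst (point 0 ∈_) e (∈-map⁺ point (∈-++⁺ˡ 0∈L))

  base-InBox : ∀ {L R} → Bounded L → Bounded R → InBox n (base L R)
  base-InBox bL bR p∈ with x , x′ , (e , _) , refl ← ∈-base⁻ bL bR p∈ =
    ℤ.+≤+ z≤n , ℤ.+≤+ (≤-trans (m≤m+n x x′) (≤-reflexive e)) , ℤ.+≤+ z≤n , ℤ.+≤+ z≤n

-- Counting the fringes: triangles and rectangles in base a.

module Blocks (a : ℕ) where
  -- Row j of a planar shape, of width w, becomes the interval [ja, ja + w). Rows of width at most
  -- `a` do not overlap.
  blocks : List ℕ → List ℕ
  blocks []       = []
  blocks (w ∷ ws) = upTo w ++ map (a +_) (blocks ws)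

  ∈-blocks-here : ∀ w ws {t} → t < w → t ∈ blocks (w ∷ ws)
  ∈-blocks-here w ws t<w = ∈-++⁺ˡ (∈-upTo⁺ t<w)

  ∈-blocks-there : ∀ w ws {t} → t ∈ blocks ws → a + t ∈ blocks (w ∷ ws)
  ∈-blocks-there w ws t∈ = ∈-++⁺ʳ (upTo w) (∈-map⁺ (a +_) t∈)

  ∈-blocks⁻ : ∀ w ws {t} → t ∈ blocks (w ∷ ws) → t < w ⊎ (∃ λ u → u ∈ blocks ws × t ≡ a + u)
  ∈-blocks⁻ w ws t∈ with ∈-++⁻ (upTo w) t∈
  ... | inj₁ t∈upTo = inj₁ (∈-upTo⁻ t∈upTo)
  ... | inj₂ t∈map  = inj₂ (∈-map⁻ (a +_) t∈map)

  blocks-unique : ∀ {ws} → All (_≤ a) ws → Unique (blocks ws)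
  blocks-unique []           = Unique.upTo⁺ 0
  blocks-unique (w≤a ∷ ws≤a) = Unique.++⁺ (Unique.upTo⁺ _)
    (Unique.map⁺ (+-cancelˡ-≡ a _ _) (blocks-unique ws≤a)) (disjoint w≤a)
    where
    disjoint : ∀ {w ws t} → w ≤ a → ¬ (t ∈ upTo w × t ∈ map (a +_) ws)
    disjoint w≤a (t∈ , t∈′) with u , _ , refl ← ∈-map⁻ (a +_) t∈′ =
      <⇒≱ (<-≤-trans (∈-upTo⁻ t∈) w≤a) (m≤m+n a u)

  length-blocks : ∀ ws → length (blocks ws) ≡ sum ws
  length-blocks []       = refl
  length-blocks (w ∷ ws) = trans (length-++ (upTo w)) (cong₂ _+_ (length-upTo w)
    (trans (length-map (a +_) (blocks ws)) (length-blocks ws)))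

module _ {L R : List ℕ} (0∈L : 0 ∈ L) (1∈L : 1 ∈ L) (0∈R : 0 ∈ R) where

  -- Take `t` ones from `L` and fill up with zeros.
  ≤⇒Sumset : ∀ {s t} d → t ≤ s → Sumset L R s d t
  ≤⇒Sumset (suc d) p       = right 0∈R (≤⇒Sumset d p)
  ≤⇒Sumset zero (z≤n {zero})  = nil
  ≤⇒Sumset zero (z≤n {suc s}) = left 0∈L (≤⇒Sumset zero z≤n)
  ≤⇒Sumset zero (s≤s p)       = left 1∈L (≤⇒Sumset zero p)

Enumerates-swap : ∀ {L R s d X} → Enumerates (Sumset L R d s) X → Enumerates (Sumset R L s d) X
Enumerates-swap e = record
  { unique   = unique e
  ; sound    = Sumset-swap ∘ sound e
  ; complete = complete e ∘ Sumset-swap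
  }

-- Row lengths of the set {i + j a : i + j ≤ s}.
staircase : ℕ → List ℕ
staircase zero    = 1 ∷ []
staircase (suc s) = suc (suc s) ∷ staircase s

staircase-≤ : ∀ {a} s → suc s ≤ a → All (_≤ a) (staircase s)
staircase-≤ zero    p = p ∷ []
staircase-≤ (suc s) p = p ∷ staircase-≤ s (<⇒≤ p)

-- The right side depends only on s + d, so for a fixed sum the two triangles together shrink
-- exactly as much as s * d grows.
sum-staircase : ∀ s d → sum (staircase s) + sum (staircase d) + s * d ≡ suc (sum (staircase (s + d)))
sum-staircase zero    d = cong suc (+-identityʳ _)
sum-staircase (suc s) d = begin
  suc (suc s) + sum (staircase s) + sum (staircase d) + (d + s * d)
    ≡⟨ regroup s d (sum (staircase s)) (sum (staircase d)) (s * d) ⟩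
  suc (suc (s + d)) + (sum (staircase s) + sum (staircase d) + s * d)
    ≡⟨ cong (suc (suc (s + d)) +_) (sum-staircase s d) ⟩
  suc (suc (s + d)) + suc (sum (staircase (s + d)))
    ≡⟨ +-suc (suc (suc (s + d))) (sum (staircase (s + d))) ⟩
  suc (sum (staircase (suc s + d))) ∎
  where
  open ≡-Reasoning
  regroup : ∀ s d x y z → suc (suc s) + x + y + (d + z) ≡ suc (suc (s + d)) + (x + y + z)
  regroup = solve-∀

module Triangle (a : ℕ) where
  open Blocks a

  L R : List ℕ
  L = 0 ∷ 1 ∷ a ∷ []
  R = 0 ∷ []

  triangle : ℕ → List ℕ
  triangle s = blocks (staircase s)

  -- Row j has width s + 1 - j, so each row gains one place when s grows by one. This absorbs a
  -- summand 0 or 1; a summand `a` moves to the next row instead.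
  triangle-grow : ∀ s {t} → t ∈ triangle s → t ∈ triangle (suc s) × suc t ∈ triangle (suc s)
  triangle-grow zero t∈ with ∈-blocks⁻ 1 [] t∈
  ... | inj₁ t<1 = ∈-blocks-here 2 (1 ∷ []) (m<n⇒m<1+n t<1) , ∈-blocks-here 2 (1 ∷ []) (s≤s t<1)
  triangle-grow (suc s) t∈ with ∈-blocks⁻ (suc (suc s)) (staircase s) t∈
  ... | inj₁ t<w =
    ∈-blocks-here (3 + s) (staircase (suc s)) (m<n⇒m<1+n t<w) ,
    ∈-blocks-here (3 + s) (staircase (suc s)) (s≤s t<w)
  ... | inj₂ (u , u∈ , refl) with p , q ← triangle-grow s u∈ =
    ∈-blocks-there (3 + s) (staircase (suc s)) p ,
    subst (_∈ triangle (suc (suc s))) (+-suc a u) (∈-blocks-there (3 + s) (staircase (suc s)) q)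

  triangle-sound : ∀ s d {t} → t ∈ triangle s → Sumset L R s d t
  triangle-sound zero d t∈ with ∈-blocks⁻ 1 [] t∈
  ... | inj₁ t<1 = ≤⇒Sumset (here refl) (there (here refl)) (here refl) d (≤-pred t<1)
  triangle-sound (suc s) d t∈ with ∈-blocks⁻ (suc (suc s)) (staircase s) t∈
  ... | inj₁ t<w = ≤⇒Sumset (here refl) (there (here refl)) (here refl) d (≤-pred t<w)
  ... | inj₂ (u , u∈ , refl) = left (there (there (here refl))) (triangle-sound s d u∈)

  triangle-complete : ∀ {s d t} → Sumset L R s d t → t ∈ triangle s
  triangle-complete nil = ∈-blocks-here 1 [] (s≤s z≤n)
  triangle-complete {suc s} (left (here refl) u) = proj₁ (triangle-grow s (triangle-complete u))
  triangle-complete {suc s} (left (there (here refl)) u) = proj₂ (triangle-grow s (triangle-complete u))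
  triangle-complete {suc s} (left (there (there (here refl))) u) =
    ∈-blocks-there (2 + s) (staircase s) (triangle-complete u)
  triangle-complete (right (here refl) u) = triangle-complete u

  triangle-enumerates : ∀ {s} d → suc s ≤ a → Enumerates (Sumset L R s d) (triangle s)
  triangle-enumerates {s} d s<a = record
    { unique   = blocks-unique (staircase-≤ s s<a)
    ; sound    = triangle-sound s d
    ; complete = triangle-complete
    }

module Rectangle (a : ℕ) where
  open Blocks a

  L R : List ℕ
  L = 0 ∷ 1 ∷ []
  R = 0 ∷ a ∷ []

  rows : ℕ → ℕ → List ℕ
  rows k w = blocks (replicate k w)

  -- The set {i + ja : i ≤ s, j ≤ d}: `L` supplies the ones and `R` the multiples of `a`.
  rectangle : ℕ → ℕ → List ℕ
  rectangle s d = rows (suc d) (suc s)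

  rows-widen : ∀ k {w t} → t ∈ rows k w → t ∈ rows k (suc w) × suc t ∈ rows k (suc w)
  rows-widen (suc k) {w} t∈ with ∈-blocks⁻ w (replicate k w) t∈
  ... | inj₁ t<w =
    ∈-blocks-here (suc w) (replicate k (suc w)) (m<n⇒m<1+n t<w) ,
    ∈-blocks-here (suc w) (replicate k (suc w)) (s≤s t<w)
  ... | inj₂ (u , u∈ , refl) with p , q ← rows-widen k u∈ =
    ∈-blocks-there (suc w) (replicate k (suc w)) p ,
    subst (_∈ rows (suc k) (suc w)) (+-suc a u) (∈-blocks-there (suc w) (replicate k (suc w)) q)

  rows-extend : ∀ k {w t} → t ∈ rows k w → t ∈ rows (suc k) w
  rows-extend (suc k) {w} t∈ with ∈-blocks⁻ w (replicate k w) t∈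
  ... | inj₁ t<w = ∈-blocks-here w (replicate (suc k) w) t<w
  ... | inj₂ (u , u∈ , refl) = ∈-blocks-there w (replicate (suc k) w) (rows-extend k u∈)

  rectangle-sound : ∀ s d {t} → t ∈ rectangle s d → Sumset L R s d t
  rectangle-sound s zero t∈ with ∈-blocks⁻ (suc s) [] t∈
  ... | inj₁ t<w = ≤⇒Sumset (here refl) (there (here refl)) (here refl) 0 (≤-pred t<w)
  rectangle-sound s (suc d) t∈ with ∈-blocks⁻ (suc s) (replicate (suc d) (suc s)) t∈
  ... | inj₁ t<w = ≤⇒Sumset (here refl) (there (here refl)) (here refl) (suc d) (≤-pred t<w)
  ... | inj₂ (u , u∈ , refl) = right (there (here refl)) (rectangle-sound s d u∈)

  rectangle-complete : ∀ {s d t} → Sumset L R s d t → t ∈ rectangle s d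
  rectangle-complete nil = ∈-blocks-here 1 [] (s≤s z≤n)
  rectangle-complete {d = d} (left (here refl) u) = proj₁ (rows-widen (suc d) (rectangle-complete u))
  rectangle-complete {d = d} (left (there (here refl)) u) = proj₂ (rows-widen (suc d) (rectangle-complete u))
  rectangle-complete {d = suc d} (right (here refl) u) = rows-extend (suc d) (rectangle-complete u)
  rectangle-complete {s} {suc d} (right (there (here refl)) u) =
    ∈-blocks-there (suc s) (replicate (suc d) (suc s)) (rectangle-complete u)

  rectangle-enumerates : ∀ {s} d → suc s ≤ a → Enumerates (Sumset L R s d) (rectangle s d)
  rectangle-enumerates {s} d s<a = record
    { unique   = blocks-unique (All.replicate⁺ (suc d) s<a)
    ; sound    = rectangle-sound s d
    ; complete = rectangle-complete
    }

  length-rows : ∀ k w → length (rows k w) ≡ k * w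
  length-rows zero    w = refl
  length-rows (suc k) w = trans (length-++ (upTo w)) (cong₂ _+_ (length-upTo w)
    (trans (length-map (a +_) (rows k w)) (length-rows k w)))

  -- Expanding 2(s + 1)(d + 1) separates the product from a term that depends only on s + d.
  length-rectangles : ∀ s d → length (rectangle s d) + length (rectangle d s) ≡
    2 * (s * d) + (2 * (s + d) + 2)
  length-rectangles s d = trans
    (cong₂ _+_ (length-rows (suc d) (suc s)) (length-rows (suc s) (suc d))) (expand s d)
    where
    expand : ∀ s d → suc d * suc s + suc s * suc d ≡ 2 * (s * d) + (2 * (s + d) + 2)
    expand = solve-∀

-- Comparing pairs with equal sum by their products.

-- With s₂ = s₁ + e the sums give d₁ = e + d₂, and the products then give e s₁ = e d₂. Either e = 0
-- or it cancels.
same-sum-product-≤ : ∀ {s₁ d₁ s₂ d₂} → s₁ ≤ s₂ → s₁ + d₁ ≡ s₂ + d₂ → s₁ * d₁ ≡ s₂ * d₂ →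
  (s₁ ≡ s₂ × d₁ ≡ d₂) ⊎ (s₁ ≡ d₂ × d₁ ≡ s₂)
same-sum-product-≤ {s} {d₁} {_} {d} s≤s₂ es ep with m≤n⇒∃[o]m+o≡n s≤s₂
... | zero , refl =
  inj₁ (sym (+-identityʳ s) , +-cancelˡ-≡ s d₁ d (trans es (cong (_+ d) (+-identityʳ s))))
... | suc e , refl with refl ← +-cancelˡ-≡ s d₁ (suc e + d) (trans es (+-assoc s (suc e) d)) =
  inj₂ (s≡d , trans (+-comm (suc e) d) (cong (_+ suc e) (sym s≡d)))
  where
  expandˡ : ∀ s e d → e * s + s * d ≡ s * (e + d)
  expandˡ = solve-∀
  expandʳ : ∀ s e d → (s + e) * d ≡ e * d + s * d
  expandʳ = solve-∀
  s≡d : s ≡ d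
  s≡d = *-cancelˡ-≡ s d (suc e) (+-cancelʳ-≡ (s * d) (suc e * s) (suc e * d)
    (trans (expandˡ s (suc e) d) (trans ep (expandʳ s (suc e) d))))

same-sum-product : ∀ {s₁ d₁ s₂ d₂} → s₁ + d₁ ≡ s₂ + d₂ → s₁ * d₁ ≡ s₂ * d₂ →
  (s₁ ≡ s₂ × d₁ ≡ d₂) ⊎ (s₁ ≡ d₂ × d₁ ≡ s₂)
same-sum-product {s₁} {d₁} {s₂} {d₂} es ep with ≤-total s₁ s₂
... | inj₁ s₁≤s₂ = same-sum-product-≤ s₁≤s₂ es ep
... | inj₂ s₂≤s₁ with same-sum-product-≤ s₂≤s₁ (sym es) (sym ep)
...   | inj₁ (e , e′) = inj₁ (sym e , sym e′)
...   | inj₂ (e , e′) = inj₂ (sym e′ , sym e)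

larger-complement : ∀ {x y p q} → x + p ≡ y + q → p < q → y < x
larger-complement {x} {y} e p<q = ≰⇒> λ x≤y → <⇒≢ (+-mono-≤-< x≤y p<q) e

module Examples (m : ℕ) where
  h a : ℕ
  h = suc m
  a = suc h
  -- `a = h + 1` is the largest possible row width, so rows stay disjoint, and `K = a * a` exceeds
  -- `h * a`.
  open Construction h a (a * a) (m<n+m (h * a) {a} (s≤s z≤n)) (m≤m*n a a) public
  module T = Triangle a
  module Q = Rectangle a
  open Blocks a using (length-blocks)

  T-bounds : Bounded T.L × Bounded T.R
  T-bounds = (λ { (here refl) → z≤n ; (there (here refl)) → s≤s z≤n
                ; (there (there (here refl))) → ≤-refl })
           , λ { (here refl) → z≤n }

  Q-bounds : Bounded Q.L × Bounded Q.R
  Q-bounds = (λ { (here refl) → z≤n ; (there (here refl)) → s≤s z≤n })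
           , λ { (here refl) → z≤n ; (there (here refl)) → ≤-refl }

  middle-size : ℕ
  middle-size = suc (2 * (a * a) + m * n)

  module _ {s d : ℕ} (e : s + d ≡ h) where
    s<a : suc s ≤ a
    s<a = s≤s (≤-trans (m≤m+n s d) (≤-reflexive e))

    d<a : suc d ≤ a
    d<a = s≤s (≤-trans (m≤n+m d s) (≤-reflexive e))

    card-T : card (sumDiff s d (base T.L T.R)) ≡
      sum (staircase s) + sum (staircase d) + middle-size
    card-T = trans
      (card-sumDiff (proj₁ T-bounds) (proj₂ T-bounds) (here refl) (here refl) e (≤-reflexive e)
        (T.triangle-enumerates d s<a) (Enumerates-swap (T.triangle-enumerates s d<a)))
      (cong (_+ middle-size) (cong₂ _+_ (length-blocks (staircase s)) (length-blocks (staircase d))))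

    card-Q : card (sumDiff s d (base Q.L Q.R)) ≡
      2 * (s * d) + (2 * (s + d) + 2) + middle-size
    card-Q = trans
      (card-sumDiff (proj₁ Q-bounds) (proj₂ Q-bounds) (here refl) (here refl) e (≤-reflexive e)
        (Q.rectangle-enumerates d s<a) (Enumerates-swap (Q.rectangle-enumerates s d<a)))
      (cong (_+ middle-size) (Q.length-rectangles s d))

theorem2p1 : (s₁ d₁ s₂ d₂ : ℕ) →
    ¬ ((s₁ ≡ s₂ × d₁ ≡ d₂) ⊎ (s₁ ≡ d₂ × d₁ ≡ s₂)) →
    s₁ + d₁ ≡ s₂ + d₂ →
    s₁ + d₁ ≥ 2 →
    Σ (List Point) λ A → Σ ℕ λ n →
    (A ≢ []) × InBox n A × (card (sumDiff s₁ d₁ A) > card (sumDiff s₂ d₂ A))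
theorem2p1 s₁ d₁ s₂ d₂ distinct same-sum sum≥2 with m≤n⇒∃[o]m+o≡n sum≥2 | <-cmp (s₁ * d₁) (s₂ * d₂)
... | _     | tri≈ _ same-product _ = contradiction (same-sum-product same-sum same-product) distinct
... | m , e | tri< fewer _ _ =
  base T.L T.R , n , base-nonempty {T.L} {T.R} (here refl) , base-InBox (proj₁ T-bounds) (proj₂ T-bounds) ,
  subst₂ _<_ (sym (card-T {s₂} {d₂} (trans (sym same-sum) (sym e)))) (sym (card-T {s₁} {d₁} (sym e)))
    -- By `sum-staircase` both pairs reach the same total, so the smaller product leaves the larger
    -- triangles.
    (+-monoˡ-< middle-size (larger-complement
      (trans (sum-staircase s₁ d₁)
        (trans (cong (suc ∘ sum ∘ staircase) same-sum) (sym (sum-staircase s₂ d₂))))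
      fewer))
  -- Since `2 + m` equals `s₁ + d₁`, this makes `h` equal to `s₁ + d₁`.
  where open Examples (suc m)
... | m , e | tri> _ _ more =
  base Q.L Q.R , n , base-nonempty {Q.L} {Q.R} (here refl) , base-InBox (proj₁ Q-bounds) (proj₂ Q-bounds) ,
  subst₂ _<_ (sym (card-Q {s₂} {d₂} (trans (sym same-sum) (sym e)))) (sym (card-Q {s₁} {d₁} (sym e)))
    (+-monoˡ-< middle-size (subst (λ σ → 2 * (s₂ * d₂) + (2 * σ + 2) < 2 * (s₁ * d₁) + (2 * (s₁ + d₁) + 2))
      same-sum (+-monoˡ-< (2 * (s₁ + d₁) + 2) (*-monoʳ-< 2 more))))
  where open Examples (suc m)
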